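{- Let $G$ be a connected simple graph on $n\geq 1$ vertices. Then $$\mathrm{gpn}(G)\leq\frac{n}{4}\left(23\cdot 3^{\frac{n-6}{3}}+1\right).$$
   Context: All graphs are finite, simple and connected. A geodesic between vertices $u$ and $v$ of a graph $G$ is a shortest path connecting $u$ and $v$. For distinct $u,v\in V(G)$, $\mathrm{gpn}_G(u,v)$ denotes the number of shortest $u$–$v$ paths in $G$. The geodesic subpath number of a graph $G$ on $n$ vertices is $\mathrm{gpn}(G)=\sum_{\{u,v\}\subseteq V(G),\,u\neq v}\mathrm{gpn}_G(u,v)+n$ (the sum is over unordered pairs of distinct vertices; the term $n$ counts the geodesics of length zero). The exponent $\frac{n-6}{3}$ is a real number, not rounded. -}

module Defs where

open import Algebra.Bundles using (CommutativeRing)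
open import Data.Fin as Fin using (Fin)
import Data.Fin.Properties as Fin
open import Data.Integer as ℤ using (ℤ; -[1+_])
open import Data.List using (List; []; _∷_; length; lookup; head; last; map; filter; concatMap;
  allFin; upTo; cartesianProduct; cartesianProductWith)
open import Data.List.Membership.Propositional using (_∈_)
open import Data.List.Membership.Propositional.Properties
  using (∈-allFin; ∈-cartesianProductWith⁺; ∈-concatMap⁺; ∈-upTo⁺; ∈-lookup)
import Data.List.Relation.Unary.All as All
import Data.List.Relation.Unary.AllPairs as AllPairs
open import Data.List.Relation.Unary.Any as Any using (here)
open import Data.List.Relation.Unary.Linked using (Linked; linked?)
open import Data.List.Relation.Unary.Unique.Propositional using (Unique)
import Data.List.Relation.Unary.Unique.DecPropositional as DecUnique
open import Data.Nat.ListAction using (sum)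
open import Data.Maybe using (Maybe; just)
import Data.Maybe.Properties as Maybe
open import Data.Nat as ℕ using (ℕ; zero; suc)
import Data.Nat.Properties as ℕ
open import Data.Product using (∃; _×_; _,_)
open import Data.Rational using (ℚ; 0ℚ; 1ℚ; _+_; _*_; _-_; -_; 1/_; _≤_; _<_; _<?_; _≤?_; _⊔_;
  ↥_; ↧ₙ_; NonZero; Positive; NonNegative; positive; nonNegative)
open import Data.Rational.Properties
open import Data.Sum using (_⊎_; inj₁; inj₂)
open import Data.Empty using (⊥-elim)
open import Function using (case_of_)
open import Level using (0ℓ)
open import Relation.Binary using (Rel; Decidable; Symmetric; Irreflexive; tri<; tri≈; tri>)
open import Relation.Binary.PropositionalEquality
open import Relation.Nullary using (¬_; Dec; yes; no; contradiction)
open import Relation.Nullary.Decidable using (map′; _×-dec_; _→-dec_)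

open import Algebra.Properties.Semiring.Exp (CommutativeRing.semiring +-*-commutativeRing) public
  using (_^_)

------------------------------------------------------------------------
-- Graphs and geodesics

-- Adjacency is decidable because shortest paths are to be counted.
record Graph (n : ℕ) : Set₁ where
  field
    _~_      : Rel (Fin n) 0ℓ
    _~?_     : Decidable _~_
    ~-sym    : Symmetric _~_
    ~-irrefl : Irreflexive _≡_ _~_

-- A path is the list of its vertices, so its number of edges is one less
-- than the length of the list.
record IsPath {n} (G : Graph n) (u v : Fin n) (p : List (Fin n)) : Set where
  constructor mkPath
  field
    starts : head p ≡ just u
    ends   : last p ≡ just v
    linked : Linked (Graph._~_ G) p
    unique : Unique p

Connected : ∀ {n} → Graph n → Set
Connected G = ∀ u v → ∃ (IsPath G u v)

IsGeodesic : ∀ {n} → Graph n → Fin n → Fin n → List (Fin n) → Set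
IsGeodesic G u v p = IsPath G u v p × (∀ q → IsPath G u v q → length p ℕ.≤ length q)

words : ∀ n → ℕ → List (List (Fin n))
words n zero    = [] ∷ []
words n (suc k) = cartesianProductWith _∷_ (allFin n) (words n k)

-- Every list of length at most n, each exactly once.
candidates : ∀ n → List (List (Fin n))
candidates n = concatMap (words n) (upTo (suc n))

∈-words : ∀ {n} (p : List (Fin n)) → p ∈ words n (length p)
∈-words []      = here refl
∈-words (x ∷ p) = ∈-cartesianProductWith⁺ _∷_ (∈-allFin x) (∈-words p)

∈-candidates : ∀ {n} (p : List (Fin n)) → length p ℕ.≤ n → p ∈ candidates n
∈-candidates {n} p l = ∈-concatMap⁺ (words n)
  (Any.map (λ { refl → ∈-words p }) (∈-upTo⁺ (ℕ.s≤s l)))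

unique⇒lookup-injective : ∀ {A : Set} {xs : List A} → Unique xs →
  ∀ {i j} → lookup xs i ≡ lookup xs j → i ≡ j
unique⇒lookup-injective (_  AllPairs.∷ _) {Fin.zero}  {Fin.zero}  _  = refl
unique⇒lookup-injective (px AllPairs.∷ _) {Fin.zero}  {Fin.suc j} eq =
  contradiction eq (All.lookup px (∈-lookup j))
unique⇒lookup-injective (px AllPairs.∷ _) {Fin.suc i} {Fin.zero}  eq =
  contradiction (sym eq) (All.lookup px (∈-lookup i))
unique⇒lookup-injective (_  AllPairs.∷ u) {Fin.suc i} {Fin.suc j} eq =
  cong Fin.suc (unique⇒lookup-injective u eq)

unique⇒length≤ : ∀ {n} {p : List (Fin n)} → Unique p → length p ℕ.≤ n
unique⇒length≤ u = Fin.injective⇒≤ (unique⇒lookup-injective u)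

isPath? : ∀ {n} (G : Graph n) u v p → Dec (IsPath G u v p)
isPath? G u v p = map′
  (λ (s , e , l , un) → mkPath s e l un)
  (λ (mkPath s e l un) → s , e , l , un)
  (Maybe.≡-dec Fin._≟_ (head p) (just u)
    ×-dec Maybe.≡-dec Fin._≟_ (last p) (just v)
    ×-dec linked? (Graph._~?_ G) p
    ×-dec DecUnique.unique? Fin._≟_ p)

isGeodesic? : ∀ {n} (G : Graph n) u v p → Dec (IsGeodesic G u v p)
isGeodesic? {n} G u v p = isPath? G u v p ×-dec map′
  (λ h q π → All.lookup h (∈-candidates q (unique⇒length≤ (IsPath.unique π))) π)
  (λ h → All.tabulate (λ {q} _ → h q))
  (All.all? (λ q → isPath? G u v q →-dec (length p ℕ.≤? length q)) (candidates n))

gpn⟨_⟩ : ∀ {n} → Graph n → Fin n → Fin n → ℕ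
gpn⟨_⟩ {n} G u v = length (filter (isGeodesic? G u v) (candidates n))

-- Unordered pairs of distinct vertices are represented by the pairs u < v.
gpn : ∀ {n} → Graph n → ℕ
gpn {n} G =
  sum (map (λ (u , v) → gpn⟨ G ⟩ u v)
           (filter (λ (u , v) → u Fin.<? v) (cartesianProduct (allFin n) (allFin n))))
  ℕ.+ n

------------------------------------------------------------------------
-- Dedekind reals

record ℝ : Set₁ where
  field
    L U       : ℚ → Set
    L-inhab   : ∃ L
    U-inhab   : ∃ U
    L-lower   : ∀ {p q} → p < q → L q → L p
    U-upper   : ∀ {p q} → p < q → U p → U q
    L-rounded : ∀ {p} → L p → ∃ λ q → p < q × L q
    U-rounded : ∀ {q} → U q → ∃ λ p → p < q × U p
    disjoint  : ∀ {p} → L p → ¬ U p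
    located   : ∀ {p q} → p < q → L p ⊎ U q

open ℝ

infix 4 _≤ᴿ_
_≤ᴿ_ : ℝ → ℝ → Set
x ≤ᴿ y = ∀ {p} → L x p → L y p

p-1<p : ∀ p → p - 1ℚ < p
p-1<p p = subst (p - 1ℚ <_) (+-identityʳ p) (+-monoʳ-< p {y = 0ℚ} (negative⁻¹ (- 1ℚ)))

p<p+1 : ∀ p → p < p + 1ℚ
p<p+1 p = subst (_< p + 1ℚ) (+-identityʳ p) (+-monoʳ-< p (positive⁻¹ 1ℚ))

fromℚ : ℚ → ℝ
fromℚ a = record
  { L = _< a
  ; U = a <_
  ; L-inhab = a - 1ℚ , p-1<p a
  ; U-inhab = a + 1ℚ , p<p+1 a
  ; L-lower = <-trans
  ; U-upper = λ p<q a<p → <-trans a<p p<q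
  ; L-rounded = λ p<a → let m , p<m , m<a = <-dense p<a in m , p<m , m<a
  ; U-rounded = λ a<q → let m , a<m , m<q = <-dense a<q in m , m<q , a<m
  ; disjoint = <-asym
  ; located = λ {p} {q} p<q → case p <? a of λ where
      (yes p<a) → inj₁ p<a
      (no  p≮a) → inj₂ (≤-<-trans (≮⇒≥ p≮a) p<q)
  }

x-b+b : ∀ x b → (x - b) + b ≡ x
x-b+b x b = trans (+-assoc x (- b) b) (trans (cong (x +_) (+-inverseˡ b)) (+-identityʳ x))

x+b-b : ∀ x b → (x + b) - b ≡ x
x+b-b x b = trans (+-assoc x b (- b)) (trans (cong (x +_) (+-inverseʳ b)) (+-identityʳ x))

infixl 6 _⊕_
_⊕_ : ℝ → ℚ → ℝ
x ⊕ b = record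
  { L = λ p → L x (p - b)
  ; U = λ q → U x (q - b)
  ; L-inhab = let r , h = L-inhab x in r + b , subst (L x) (sym (x+b-b r b)) h
  ; U-inhab = let r , h = U-inhab x in r + b , subst (U x) (sym (x+b-b r b)) h
  ; L-lower = λ p<q → L-lower x (+-monoˡ-< (- b) p<q)
  ; U-upper = λ p<q → U-upper x (+-monoˡ-< (- b) p<q)
  ; L-rounded = λ {p} h → let r , p-b<r , h′ = L-rounded x h in
      r + b , subst (_< r + b) (x-b+b p b) (+-monoˡ-< b p-b<r)
            , subst (L x) (sym (x+b-b r b)) h′
  ; U-rounded = λ {q} h → let r , r<q-b , h′ = U-rounded x h in
      r + b , subst (r + b <_) (x-b+b q b) (+-monoˡ-< b r<q-b)
            , subst (U x) (sym (x+b-b r b)) h′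
  ; disjoint = disjoint x
  ; located = λ p<q → located x (+-monoˡ-< (- b) p<q)
  }

L<U : ∀ x {p q} → L x p → U x q → p < q
L<U x {p} {q} l u with <-cmp p q
... | tri< p<q _ _   = p<q
... | tri≈ _ refl _  = ⊥-elim (disjoint x l u)
... | tri> _ _ q<p   = ⊥-elim (disjoint x (L-lower x q<p l) u)

-- For a > 0 the strict inequalities could be equalities; they make the
-- same formula correct for a = 0.
infixr 7 _·_
_·_ : (a : ℚ) .{{_ : NonNegative a}} → ℝ → ℝ
a · x = record
  { L = Lo
  ; U = Up
  ; L-inhab = let r , h = L-inhab x in a * r - 1ℚ , r , h , p-1<p (a * r)
  ; U-inhab = let r , h = U-inhab x in a * r + 1ℚ , r , h , p<p+1 (a * r)
  ; L-lower = λ p<q (r , h , q<) → r , h , <-trans p<q q<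
  ; U-upper = λ p<q (r , h , <p) → r , h , <-trans <p p<q
  ; L-rounded = λ (r , h , p<) → let m , p<m , m< = <-dense p< in m , p<m , r , h , m<
  ; U-rounded = λ (r , h , <q) → let m , <m , m<q = <-dense <q in m , m<q , r , h , <m
  ; disjoint = λ (r , l , p<ar) (s , u , as<p) →
      <-irrefl refl (<-≤-trans (<-trans as<p p<ar)
        (*-monoˡ-≤-nonNeg a (<⇒≤ (L<U x l u))))
  ; located = loc
  }
  where
  Lo Up : ℚ → Set
  Lo p = ∃ λ r → L x r × p < a * r
  Up q = ∃ λ r → U x r × a * r < q

  loc : ∀ {p q} → p < q → Lo p ⊎ Up q
  loc {p} {q} p<q with <-cmp 0ℚ a
  ... | tri> _ _ a<0 = ⊥-elim (<-irrefl refl (<-≤-trans a<0 (nonNegative⁻¹ a)))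
  ... | tri≈ _ refl _ with p <? 0ℚ
  ...   | yes p<0 = let r , h = L-inhab x in inj₁ (r , h , subst (p <_) (sym (*-zeroˡ r)) p<0)
  ...   | no  p≮0 = let r , h = U-inhab x in
          inj₂ (r , h , subst (_< q) (sym (*-zeroˡ r)) (≤-<-trans (≮⇒≥ p≮0) p<q))
  loc {p} {q} p<q | tri< 0<a _ _ =
    let instance _ = positive 0<a
                 _ = pos⇒nonZero a
                 _ = 1/pos⇒pos a
        m , p<m , m<q = <-dense p<q
        k , m<k , k<q = <-dense m<q
    in case located x (*-monoʳ-<-pos (1/ a) m<k) of λ where
         (inj₁ l) → inj₁ (_ , l , subst (p <_) (sym (a*a⁻¹ m)) p<m)
         (inj₂ u) → inj₂ (_ , u , subst (_< q) (sym (a*a⁻¹ k)) k<q)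
    where
    a*a⁻¹ : .{{_ : NonZero a}} → ∀ r → a * (1/ a * r) ≡ r
    a*a⁻¹ r = trans (sym (*-assoc a (1/ a) r))
      (trans (cong (_* r) (*-inverseʳ a)) (*-identityˡ r))

------------------------------------------------------------------------
-- Real powers of positive rationals, with rational exponents

^-nonNeg : ∀ {r} k → 0ℚ ≤ r → 0ℚ ≤ r ^ k
^-nonNeg zero    _   = nonNegative⁻¹ 1ℚ
^-nonNeg {r} (suc k) 0≤r = let instance _ = nonNegative 0≤r in
  subst (_≤ r * r ^ k) (*-zeroʳ r) (*-monoˡ-≤-nonNeg r (^-nonNeg k 0≤r))

^-pos : ∀ {r} k → 0ℚ < r → 0ℚ < r ^ k
^-pos zero    _   = positive⁻¹ 1ℚ
^-pos {r} (suc k) 0<r = let instance _ = positive 0<r in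
  subst (_< r * r ^ k) (*-zeroʳ r) (*-monoʳ-<-pos r (^-pos k 0<r))

^-mono-≤ : ∀ {s r} k → 0ℚ ≤ s → s ≤ r → s ^ k ≤ r ^ k
^-mono-≤ zero _ _ = ≤-refl
^-mono-≤ {s} {r} (suc k) 0≤s s≤r =
  let instance _ = nonNegative 0≤s
               _ = nonNegative (^-nonNeg k (≤-trans 0≤s s≤r))
  in ≤-trans (*-monoˡ-≤-nonNeg s (^-mono-≤ k 0≤s s≤r)) (*-monoʳ-≤-nonNeg (r ^ k) s≤r)

^-mono-< : ∀ {s r} k .{{_ : ℕ.NonZero k}} → 0ℚ ≤ s → s < r → s ^ k < r ^ k
^-mono-< {s} {r} (suc k) 0≤s s<r =
  let instance _ = nonNegative 0≤s
               _ = positive (^-pos k (≤-<-trans 0≤s s<r))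
  in ≤-<-trans (*-monoˡ-≤-nonNeg s (^-mono-≤ k 0≤s (<⇒≤ s<r))) (*-monoˡ-<-pos (r ^ k) s<r)

1≤^ : ∀ {r} k → 1ℚ ≤ r → 1ℚ ≤ r ^ k
1≤^ zero    _   = ≤-refl
1≤^ {r} (suc k) 1≤r = let instance _ = nonNegative (≤-trans (nonNegative⁻¹ 1ℚ) 1≤r) in
  ≤-trans (subst (1ℚ ≤_) (sym (*-identityʳ r)) 1≤r) (*-monoˡ-≤-nonNeg r (1≤^ k 1≤r))

r≤^ : ∀ {r} k .{{_ : ℕ.NonZero k}} → 1ℚ ≤ r → r ≤ r ^ k
r≤^ {r} (suc k) 1≤r = let instance _ = nonNegative (≤-trans (nonNegative⁻¹ 1ℚ) 1≤r) in
  subst (_≤ r * r ^ k) (*-identityʳ r) (*-monoˡ-≤-nonNeg r (1≤^ k 1≤r))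

-- The nonnegative k-th root of c ≥ 0: the supremum of the r ≥ 0 with
-- r ^ k ≤ c and the infimum of the r ≥ 0 with c ≤ r ^ k.
root : (k : ℕ) .{{_ : ℕ.NonZero k}} (c : ℚ) → 0ℚ ≤ c → ℝ
root k c 0≤c = record
  { L = Lo
  ; U = Up
  ; L-inhab = - 1ℚ , 0ℚ , ≤-refl , 0^k≤c k , negative⁻¹ (- 1ℚ)
  ; U-inhab = let c⊔1 = c ⊔ 1ℚ in
      c⊔1 + 1ℚ , c⊔1 , ≤-trans 0≤c (p≤p⊔q c 1ℚ)
      , ≤-trans (p≤p⊔q c 1ℚ) (r≤^ k (p≤q⊔p c 1ℚ)) , p<p+1 c⊔1
  ; L-lower = λ p<q (r , 0≤r , h , q<r) → r , 0≤r , h , <-trans p<q q<r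
  ; U-upper = λ p<q (r , 0≤r , h , r<p) → r , 0≤r , h , <-trans r<p p<q
  ; L-rounded = λ (r , 0≤r , h , p<r) →
      let m , p<m , m<r = <-dense p<r in m , p<m , r , 0≤r , h , m<r
  ; U-rounded = λ (r , 0≤r , h , r<q) →
      let m , r<m , m<q = <-dense r<q in m , m<q , r , 0≤r , h , r<m
  ; disjoint = λ (r , 0≤r , rᵏ≤c , p<r) (s , 0≤s , c≤sᵏ , s<p) →
      <-irrefl refl (<-≤-trans (^-mono-< k 0≤s (<-trans s<p p<r)) (≤-trans rᵏ≤c c≤sᵏ))
  ; located = loc
  }
  where
  Lo Up : ℚ → Set
  Lo p = ∃ λ r → 0ℚ ≤ r × r ^ k ≤ c × p < r
  Up q = ∃ λ r → 0ℚ ≤ r × c ≤ r ^ k × r < q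

  0^k≤c : ∀ k .{{_ : ℕ.NonZero k}} → 0ℚ ^ k ≤ c
  0^k≤c (suc k) = subst (_≤ c) (sym (*-zeroˡ (0ℚ ^ k))) 0≤c

  loc : ∀ {p q} → p < q → Lo p ⊎ Up q
  loc {p} {q} p<q with p <? 0ℚ
  ... | yes p<0 = inj₁ (0ℚ , ≤-refl , 0^k≤c k , p<0)
  ... | no  p≮0 =
    let m , p<m , m<q = <-dense p<q
        0≤m = ≤-trans (≮⇒≥ p≮0) (<⇒≤ p<m)
    in case ≤-total (m ^ k) c of λ where
         (inj₁ mᵏ≤c) → inj₁ (m , 0≤m , mᵏ≤c , p<m)
         (inj₂ c≤mᵏ) → inj₂ (m , 0≤m , c≤mᵏ , m<q)

infixr 8 _^ℤ_ _^ℚ_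
_^ℤ_ : (a : ℚ) .{{_ : Positive a}} → ℤ → ℚ
a ^ℤ (ℤ.+ k)    = a ^ k
a ^ℤ (-[1+ k ]) = ((1/ a) {{pos⇒nonZero a}}) ^ suc k

^ℤ-nonNeg : ∀ a .{{_ : Positive a}} z → 0ℚ ≤ a ^ℤ z
^ℤ-nonNeg a (ℤ.+ k)    = ^-nonNeg k (<⇒≤ (positive⁻¹ a))
^ℤ-nonNeg a (-[1+ k ]) =
  ^-nonNeg (suc k) (<⇒≤ (positive⁻¹ ((1/ a) {{pos⇒nonZero a}}) {{1/pos⇒pos a}}))

_^ℚ_ : (a : ℚ) .{{_ : Positive a}} → ℚ → ℝ
a ^ℚ e = root (↧ₙ e) (a ^ℤ ↥ e) (^ℤ-nonNeg a (↥ e))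

{-# OPTIONS --safe #-}

-- A geodesic ending at v descends through the spheres around v. If these have sizes a₁, a₂, … then
-- at most a₁ + a₁a₂ + a₁a₂a₃ + … nontrivial geodesics end at v. As the sizes add up to n - 1, this
-- is at most f (n - 1), where f m is the maximum of these sums over the compositions of m, attained
-- essentially by spheres of size 3: f (m + 3) = 3 (1 + f m) for m ≥ 5. Hence
-- 2 f (n - 1) + 3 ≤ 23 · 3^((n - 6) / 3). Summing over v counts every geodesic between distinct
-- vertices twice, once in each direction, so that 2 gpn(G) ≤ n (f (n - 1) + 2).
module Submission where

open import Defs
open import Algebra.Bundles using (CommutativeRing)
open import Data.Fin as Fin using (Fin)
import Data.Fin.Properties as Fin
open import Data.Integer as ℤ using (+_; -[1+_]; _-_)
import Data.Integer.Properties as ℤ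
open import Data.Integer.Solver using () renaming (module +-*-Solver to ℤ-Solver)
open import Data.List using (List; []; _∷_; _++_; _ʳ++_; length; lookup; head; last; map; filter;
  concatMap; reverse; allFin; cartesianProduct; cartesianProductWith)
open import Data.List.Extrema.Nat using (argmin; argmin-all; f[argmin]≤v⁺)
open import Data.List.Membership.Propositional using (_∈_; lose; find)
open import Data.List.Membership.Propositional.Properties
open import Data.List.Properties using (length-map; length-++; length-tabulate; filter-notAll;
  reverse-injective; reverse-involutive; length-reverse; ∷-injective)
open import Data.List.Relation.Binary.Permutation.Propositional using (↭-sym; ↭⇒↭ₛ)
open import Data.List.Relation.Binary.Permutation.Propositional.Properties using (↭-reverse)
open import Data.List.Relation.Binary.Permutation.Setoid.Properties using (Unique-resp-↭)
open import Data.List.Relation.Binary.Subset.Propositional using (_⊆_)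
open import Data.List.Relation.Unary.All as All using ([]; _∷_)
import Data.List.Relation.Unary.All.Properties as All
open import Data.List.Relation.Unary.AllPairs as AllPairs using ([]; _∷_)
import Data.List.Relation.Unary.AllPairs.Properties as AllPairs
open import Data.List.Relation.Unary.Any as Any using (here; there)
open import Data.List.Relation.Unary.Any.Properties using (lookup-index)
open import Data.List.Relation.Unary.Linked using (Linked; []; [-]; _∷_)
open import Data.List.Relation.Unary.Unique.Propositional using (Unique)
import Data.List.Relation.Unary.Unique.Propositional.Properties as Unique
open import Data.Maybe.Properties using (just-injective)
open import Data.Nat as ℕ using (ℕ; zero; suc; 2+; z≤n; s≤s; _≥_)
import Data.Nat.Properties as ℕ
open import Data.Nat.ListAction using (sum)
open import Data.Nat.Solver using () renaming (module +-*-Solver to ℕ-Solver)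
open import Data.Product using (∃; _×_; _,_; proj₁; proj₂; uncurry)
open import Data.Rational as ℚ using (ℚ; 0ℚ; 1ℚ; _/_; 1/_; ↥_; ↧_; ↧ₙ_; Positive; toℚᵘ; fromℚᵘ)
import Data.Rational.Properties as ℚ
open import Data.Rational.Properties using (normalize-nonNeg)
open import Data.Rational.Unnormalised as ℚᵘ using (mkℚᵘ; *≡*; *≤*)
import Data.Rational.Unnormalised.Properties as ℚᵘ
open import Data.Sum using (inj₁; inj₂)
open import Data.Unit using (tt)
open import Function using (_∘_; id)
open import Level using (0ℓ)
open import Relation.Binary using (Rel; Symmetric)
open import Relation.Binary.PropositionalEquality
open import Relation.Nullary using (¬_; yes; no; contradiction)
open import Relation.Unary using (Decidable)
open import Algebra.Properties.CommutativeSemiring.Exp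
  (CommutativeRing.commutativeSemiring ℚ.+-*-commutativeRing) using (^-homo-*; ^-assocʳ; ^-distrib-*)

-- The optimal composition: recursion and growth of `maxPathCount`.

pattern 3+ m = suc (2+ m)
pattern 5+ m = 3+ (2+ m)

-- The maximum of a₁ + a₁a₂ + a₁a₂a₃ + … over the compositions m = a₁ + a₂ + ….
maxPathCount : ℕ → ℕ
maxPathCount 0 = 0
maxPathCount 1 = 1
maxPathCount 2 = 2
maxPathCount 3 = 4
maxPathCount 4 = 6
maxPathCount 5 = 10
maxPathCount 6 = 15
maxPathCount 7 = 22
maxPathCount (3+ m@(5+ _)) = 3 ℕ.* suc (maxPathCount m)

-- Putting a layer of size a in front of a composition with sum s gives the sum a (1 + s). This
-- lemma and the next three check that `maxPathCount` dominates every such extension. Small cases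
-- are evaluated; the others follow the recursion, which advances by three.
maxPathCount-layer-1 : ∀ m → suc (maxPathCount m) ℕ.≤ maxPathCount (suc m)
maxPathCount-layer-1 0 = ℕ.≤ᵇ⇒≤ _ _ tt
maxPathCount-layer-1 1 = ℕ.≤ᵇ⇒≤ _ _ tt
maxPathCount-layer-1 2 = ℕ.≤ᵇ⇒≤ _ _ tt
maxPathCount-layer-1 3 = ℕ.≤ᵇ⇒≤ _ _ tt
maxPathCount-layer-1 4 = ℕ.≤ᵇ⇒≤ _ _ tt
maxPathCount-layer-1 5 = ℕ.≤ᵇ⇒≤ _ _ tt
maxPathCount-layer-1 6 = ℕ.≤ᵇ⇒≤ _ _ tt
maxPathCount-layer-1 7 = ℕ.≤ᵇ⇒≤ _ _ tt
maxPathCount-layer-1 (3+ m@(5+ _)) = begin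
  suc (3 ℕ.* suc (maxPathCount m))   ≤⟨ ℕ.+-monoˡ-≤ _ (s≤s (z≤n {2})) ⟩
  3 ℕ.+ 3 ℕ.* suc (maxPathCount m)   ≡⟨ ℕ.*-suc 3 (suc (maxPathCount m)) ⟨
  3 ℕ.* suc (suc (maxPathCount m))   ≤⟨ ℕ.*-monoʳ-≤ 3 (s≤s (maxPathCount-layer-1 m)) ⟩
  3 ℕ.* suc (maxPathCount (1 ℕ.+ m))         ∎
  where open ℕ.≤-Reasoning

maxPathCount-mono : ∀ {m n} → m ℕ.≤ n → maxPathCount m ℕ.≤ maxPathCount n
maxPathCount-mono = mono ∘ ℕ.≤⇒≤′
  where
  mono : ∀ {m n} → m ℕ.≤′ n → maxPathCount m ℕ.≤ maxPathCount n
  mono ℕ.≤′-refl          = ℕ.≤-refl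
  mono (ℕ.≤′-step {n} le) = ℕ.≤-trans (mono le) (ℕ.<⇒≤ (maxPathCount-layer-1 n))

maxPathCount-layer-2 : ∀ m → 2 ℕ.* suc (maxPathCount m) ℕ.≤ maxPathCount (2 ℕ.+ m)
maxPathCount-layer-2 0 = ℕ.≤ᵇ⇒≤ _ _ tt
maxPathCount-layer-2 1 = ℕ.≤ᵇ⇒≤ _ _ tt
maxPathCount-layer-2 2 = ℕ.≤ᵇ⇒≤ _ _ tt
maxPathCount-layer-2 3 = ℕ.≤ᵇ⇒≤ _ _ tt
maxPathCount-layer-2 4 = ℕ.≤ᵇ⇒≤ _ _ tt
maxPathCount-layer-2 5 = ℕ.≤ᵇ⇒≤ _ _ tt
maxPathCount-layer-2 6 = ℕ.≤ᵇ⇒≤ _ _ tt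
maxPathCount-layer-2 7 = ℕ.≤ᵇ⇒≤ _ _ tt
maxPathCount-layer-2 (3+ m@(5+ _)) = begin
  -- Exchanging a first layer of 2 with the layer of 3 behind it gains exactly 1.
  2 ℕ.* suc (3 ℕ.* suc x)       ≤⟨ ℕ.n≤1+n _ ⟩
  suc (2 ℕ.* suc (3 ℕ.* suc x)) ≡⟨ solve 1 (λ x → con 1 :+ con 2 :* (con 1 :+ con 3 :* (con 1 :+ x))
                                      := con 3 :* (con 1 :+ con 2 :* (con 1 :+ x))) refl x ⟩
  3 ℕ.* suc (2 ℕ.* suc x)       ≤⟨ ℕ.*-monoʳ-≤ 3 (s≤s (maxPathCount-layer-2 m)) ⟩
  3 ℕ.* suc (maxPathCount (2 ℕ.+ m)) ∎
  where
  open ℕ-Solver using (solve; _:=_; _:+_; _:*_; con)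
  open ℕ.≤-Reasoning
  x = maxPathCount m

-- From m = 5 on this is the recursion itself. It cannot start earlier: at m = 4 the inequality is
-- strict, 21 against 22.
maxPathCount-layer-3 : ∀ m → 3 ℕ.* suc (maxPathCount m) ℕ.≤ maxPathCount (3 ℕ.+ m)
maxPathCount-layer-3 0 = ℕ.≤ᵇ⇒≤ _ _ tt
maxPathCount-layer-3 1 = ℕ.≤ᵇ⇒≤ _ _ tt
maxPathCount-layer-3 2 = ℕ.≤ᵇ⇒≤ _ _ tt
maxPathCount-layer-3 3 = ℕ.≤ᵇ⇒≤ _ _ tt
maxPathCount-layer-3 4 = ℕ.≤ᵇ⇒≤ _ _ tt
maxPathCount-layer-3 (5+ m) = ℕ.≤-refl

-- A layer with a ≥ 4 vertices is no better than two layers with 2 and a - 2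
-- vertices, because a ≤ 2 (a - 2).
maxPathCount-layer : ∀ a m → a ℕ.* suc (maxPathCount m) ℕ.≤ maxPathCount (a ℕ.+ m)
maxPathCount-layer 0 m = z≤n
maxPathCount-layer 1 m = ℕ.≤-trans (ℕ.≤-reflexive (ℕ.*-identityˡ _)) (maxPathCount-layer-1 m)
maxPathCount-layer 2 m = maxPathCount-layer-2 m
maxPathCount-layer 3 m = maxPathCount-layer-3 m
maxPathCount-layer (2+ b@(2+ c)) m = begin
  (2 ℕ.+ b) ℕ.* x               ≤⟨ ℕ.*-monoˡ-≤ x (ℕ.+-monoˡ-≤ b (s≤s (s≤s (z≤n {c})))) ⟩
  (b ℕ.+ b) ℕ.* x               ≡⟨ solve 2 (λ b x → (b :+ b) :* x := con 2 :* (b :* x)) refl b x ⟩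
  2 ℕ.* (b ℕ.* x)               ≤⟨ ℕ.*-monoʳ-≤ 2 (ℕ.m≤n⇒m≤1+n (maxPathCount-layer b m)) ⟩
  2 ℕ.* suc (maxPathCount (b ℕ.+ m)) ≤⟨ maxPathCount-layer-2 (b ℕ.+ m) ⟩
  maxPathCount (2 ℕ.+ b ℕ.+ m)  ∎
  where
  open ℕ-Solver using (solve; _:=_; _:+_; _:*_; con)
  open ℕ.≤-Reasoning
  x = suc (maxPathCount m)

-- This is the cube of 2 f m + 3 ≤ 23 · 3^((m - 5) / 3), cleared of denominators: 729 = 3^6, 12167 =
-- 23^3, and n = m + 1. The shift by 3 turns the affine recursion into pure tripling, which
-- multiplies both sides by 27. Equality at m = 5, where 2 · 10 + 3 = 23, fixes the constant 23.
cubic-bound : ∀ m → 729 ℕ.* (2 ℕ.* maxPathCount m ℕ.+ 3) ℕ.^ 3 ℕ.≤ 12167 ℕ.* 3 ℕ.^ suc m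
cubic-bound 0 = ℕ.≤ᵇ⇒≤ _ _ tt
cubic-bound 1 = ℕ.≤ᵇ⇒≤ _ _ tt
cubic-bound 2 = ℕ.≤ᵇ⇒≤ _ _ tt
cubic-bound 3 = ℕ.≤ᵇ⇒≤ _ _ tt
cubic-bound 4 = ℕ.≤ᵇ⇒≤ _ _ tt
cubic-bound 5 = ℕ.≤ᵇ⇒≤ _ _ tt
cubic-bound 6 = ℕ.≤ᵇ⇒≤ _ _ tt
cubic-bound 7 = ℕ.≤ᵇ⇒≤ _ _ tt
cubic-bound (3+ m@(5+ _)) = begin
  729 ℕ.* (2 ℕ.* (3 ℕ.* suc x) ℕ.+ 3) ℕ.^ 3  ≡⟨ cong (λ y → 729 ℕ.* y ℕ.^ 3)
    (solve 1 (λ x → con 2 :* (con 3 :* (con 1 :+ x)) :+ con 3 := con 3 :* (con 2 :* x :+ con 3)) refl x) ⟩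
  729 ℕ.* (3 ℕ.* d) ℕ.^ 3 ≡⟨
    solve 1 (λ d → con 729 :* (con 3 :* d) :^ 3 := con 27 :* (con 729 :* d :^ 3)) refl d ⟩
  27 ℕ.* (729 ℕ.* d ℕ.^ 3) ≤⟨ ℕ.*-monoʳ-≤ 27 (cubic-bound m) ⟩
  27 ℕ.* (12167 ℕ.* 3 ℕ.^ suc m) ≡⟨ swap 27 12167 (3 ℕ.^ suc m) ⟩
  12167 ℕ.* (27 ℕ.* 3 ℕ.^ suc m) ≡⟨ cong (12167 ℕ.*_) (ℕ.^-distribˡ-+-* 3 3 (suc m)) ⟨
  12167 ℕ.* 3 ℕ.^ (4 ℕ.+ m) ∎
  where
  open ℕ-Solver using (solve; _:=_; _:+_; _:*_; _:^_; con)
  open ℕ.≤-Reasoning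
  x = maxPathCount m
  d = 2 ℕ.* x ℕ.+ 3
  swap : ∀ a b c → a ℕ.* (b ℕ.* c) ≡ b ℕ.* (a ℕ.* c)
  swap = solve 3 (λ a b c → a :* (b :* c) := b :* (a :* c)) refl

-- Lists: counting, disjointness and reversal.

private variable
  A B C : Set

-- Sending each position in `xs` to the position of its entry in `ys` is injective.
unique-⊆⇒length≤ : {xs ys : List A} → Unique xs → xs ⊆ ys → length xs ℕ.≤ length ys
unique-⊆⇒length≤ {xs = xs} {ys} uniq sub = Fin.injective⇒≤ position-injective
  where
  mem : ∀ i → lookup xs i ∈ ys
  mem i = sub (∈-lookup i)

  position-injective : ∀ {i j} → Any.index (mem i) ≡ Any.index (mem j) → i ≡ j
  position-injective {i} {j} eq = unique⇒lookup-injective uniq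
    (trans (lookup-index (mem i)) (trans (cong (lookup ys) eq) (sym (lookup-index (mem j)))))

concatMap-unique : {f : A → List B} {xs : List A} → Unique xs → (∀ x → Unique (f x)) →
  (∀ {x y z} → z ∈ f x → z ∈ f y → x ≡ y) → Unique (concatMap f xs)
concatMap-unique {xs = xs} uniq uniqᶠ disj = Unique.concat⁺
  (All.map⁺ (All.universal uniqᶠ xs))
  (AllPairs.map⁺ (AllPairs.map (λ x≢y {_} (∈x , ∈y) → x≢y (disj ∈x ∈y)) uniq))

length-concatMap : (f : A → List B) (xs : List A) →
  length (concatMap f xs) ≡ sum (map (length ∘ f) xs)
length-concatMap f []       = refl
length-concatMap f (x ∷ xs) =
  trans (length-++ (f x)) (cong (length (f x) ℕ.+_) (length-concatMap f xs))

length-concatMap-≤ : ∀ {b} (f : A → List B) (xs : List A) → (∀ x → length (f x) ℕ.≤ b) →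
  length (concatMap f xs) ℕ.≤ length xs ℕ.* b
length-concatMap-≤ f []       bound = z≤n
length-concatMap-≤ f (x ∷ xs) bound = ℕ.≤-trans (ℕ.≤-reflexive (length-++ (f x)))
  (ℕ.+-mono-≤ (bound x) (length-concatMap-≤ f xs bound))

length-cartesianProductWith : (f : A → B → C) (xs : List A) (ys : List B) →
  length (cartesianProductWith f xs ys) ≡ length xs ℕ.* length ys
length-cartesianProductWith f []       ys = refl
length-cartesianProductWith f (x ∷ xs) ys = trans (length-++ (map (f x) ys))
  (cong₂ ℕ._+_ (length-map (f x) ys) (length-cartesianProductWith f xs ys))

length-filter-disjoint : {P Q R : A → Set} (P? : Decidable P) (Q? : Decidable Q) (R? : Decidable R) →
  (∀ {x} → Q x → P x) → (∀ {x} → R x → P x) → (∀ {x} → Q x → ¬ R x) → ∀ xs →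
  length (filter Q? xs) ℕ.+ length (filter R? xs) ℕ.≤ length (filter P? xs)
length-filter-disjoint P? Q? R? Q⇒P R⇒P disj [] = z≤n
length-filter-disjoint P? Q? R? Q⇒P R⇒P disj (x ∷ xs)
  with length-filter-disjoint P? Q? R? Q⇒P R⇒P disj xs | P? x | Q? x | R? x
... | ih | _      | yes q | yes r = contradiction r (disj q)
... | ih | yes _  | yes _ | no _  = s≤s ih
... | ih | yes _  | no _  | yes _ = ℕ.≤-trans (ℕ.≤-reflexive (ℕ.+-suc _ _)) (s≤s ih)
... | ih | yes _  | no _  | no _  = ℕ.m≤n⇒m≤1+n ih
... | ih | no _   | no _  | no _  = ih
... | ih | no ¬p  | yes q | _     = contradiction (Q⇒P q) ¬p
... | ih | no ¬p  | _     | yes r = contradiction (R⇒P r) ¬p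

head-ʳ++ : ∀ x (xs ys : List A) → head ((x ∷ xs) ʳ++ ys) ≡ last (x ∷ xs)
head-ʳ++ x []       ys = refl
head-ʳ++ x (y ∷ xs) ys = head-ʳ++ y xs (x ∷ ys)

head-reverse : (xs : List A) → head (reverse xs) ≡ last xs
head-reverse []       = refl
head-reverse (x ∷ xs) = head-ʳ++ x xs []

last-reverse : (xs : List A) → last (reverse xs) ≡ head xs
last-reverse xs = trans (sym (head-reverse (reverse xs))) (cong head (reverse-involutive xs))

-- Reversal pushes `x` onto the accumulator `ys` first, so both hypotheses share the head `x`; this
-- form survives the induction.
Linked-ʳ++ : {R : Rel A 0ℓ} → Symmetric R → ∀ {x xs ys} →
  Linked R (x ∷ xs) → Linked R (x ∷ ys) → Linked R ((x ∷ xs) ʳ++ ys)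
Linked-ʳ++ R-sym [-]     m = m
Linked-ʳ++ R-sym (r ∷ l) m = Linked-ʳ++ R-sym l (R-sym r ∷ m)

Linked-reverse : {R : Rel A 0ℓ} → Symmetric R → ∀ {xs} → Linked R xs → Linked R (reverse xs)
Linked-reverse R-sym {[]}     l = []
Linked-reverse R-sym {x ∷ xs} l = Linked-ʳ++ R-sym l [-]

-- The enumeration of candidate paths has no repetitions.

words-unique : ∀ n k → Unique (words n k)
words-unique n zero    = [] ∷ []
words-unique n (suc k) =
  Unique.cartesianProductWith⁺ _∷_ ∷-injective (Unique.allFin⁺ n) (words-unique n k)

∈-words⇒length : ∀ n k {p} → p ∈ words n k → length p ≡ k
∈-words⇒length n zero    (here refl) = refl
∈-words⇒length n (suc k) p∈ with ∈-cartesianProductWith⁻ _∷_ (allFin n) (words n k) p∈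
... | _ , _ , _ , q∈ , refl = cong suc (∈-words⇒length n k q∈)

candidates-unique : ∀ n → Unique (candidates n)
candidates-unique n = concatMap-unique (Unique.upTo⁺ (suc n)) (words-unique n)
  (λ {k} {l} ∈k ∈l → trans (sym (∈-words⇒length n k ∈k)) (∈-words⇒length n l ∈l))

-- Paths and geodesics: reversal, tails and existence.

module _ {n : ℕ} (G : Graph n) where
  open Graph G
  open IsPath

  IsPath-reverse : ∀ {u v p} → IsPath G u v p → IsPath G v u (reverse p)
  IsPath-reverse {p = p} (mkPath s e l un) = mkPath
    (trans (head-reverse p) e)
    (trans (last-reverse p) s)
    (Linked-reverse ~-sym l)
    (Unique-resp-↭ (setoid (Fin n)) (↭⇒↭ₛ (↭-sym (↭-reverse p))) un)

  IsGeodesic-reverse : ∀ {u v p} → IsGeodesic G u v p → IsGeodesic G v u (reverse p)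
  IsGeodesic-reverse {p = p} (path , shortest) = IsPath-reverse path , λ q path′ →
    subst₂ ℕ._≤_ (sym (length-reverse p)) (length-reverse q)
      (shortest (reverse q) (IsPath-reverse path′))

  IsPath-tail : ∀ {x v x′ y p} → IsPath G x v (x′ ∷ y ∷ p) → IsPath G y v (y ∷ p)
  IsPath-tail (mkPath _ e (_ ∷ l) (_ ∷ un)) = mkPath refl e l un

  IsPath-suffix : ∀ {x y v p} → x ∈ p → IsPath G y v p →
    ∃ λ q → IsPath G x v q × length q ℕ.≤ length p
  IsPath-suffix (here refl) (mkPath s e l un) = _ , mkPath refl e l un , ℕ.≤-refl
  IsPath-suffix {p = _ ∷ _ ∷ _} (there x∈p) path =
    let q , path′ , q≤p = IsPath-suffix x∈p (IsPath-tail path)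
    in q , path′ , ℕ.m≤n⇒m≤1+n q≤p

  -- Prepending `x` could repeat a vertex; in that case the path is cut at `x` instead, which only
  -- shortens it.
  IsPath-∷ : ∀ {x y v p} → x ~ y → IsPath G y v p →
    ∃ λ q → IsPath G x v q × length q ℕ.≤ suc (length p)
  IsPath-∷ {x} {p = z ∷ p} x~y path@(mkPath refl e l un) with Any.any? (x Fin.≟_) (z ∷ p)
  ... | yes x∈p = let q , path′ , q≤p = IsPath-suffix x∈p path in q , path′ , ℕ.m≤n⇒m≤1+n q≤p
  ... | no  x∉p = _ , mkPath refl e (x~y ∷ l) (All.¬Any⇒All¬ _ x∉p ∷ un) , ℕ.≤-refl

  -- A shorter path from `y` would extend along the first edge to a shorter path from `x`.
  IsGeodesic-tail : ∀ {x v x′ y p} → IsGeodesic G x v (x′ ∷ y ∷ p) → IsGeodesic G y v (y ∷ p)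
  IsGeodesic-tail (path@(mkPath refl _ (x~y ∷ _) _) , shortest) = IsPath-tail path , λ q path′ →
    let r , path″ , r≤q = IsPath-∷ x~y path′ in ℕ.s≤s⁻¹ (ℕ.≤-trans (shortest r path″) r≤q)

  -- All paths occur among the finitely many candidates, so one of minimal length can be selected.
  -- The path supplied by connectedness is the default value of `argmin`.
  geodesic : Connected G → ∀ u v → ∃ (IsGeodesic G u v)
  geodesic conn u v = p
    , argmin-all length (proj₂ (conn u v)) (All.all-filter (isPath? G u v) (candidates n))
    , λ q path → f[argmin]≤v⁺ _ paths (inj₂ (lose
        (∈-filter⁺ (isPath? G u v) (∈-candidates q (unique⇒length≤ (unique path))) path) ℕ.≤-refl))
    where
    paths = filter (isPath? G u v) (candidates n)
    p = argmin length (proj₁ (conn u v)) paths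

  geodesics : Fin n → Fin n → List (List (Fin n))
  geodesics u v = filter (isGeodesic? G u v) (candidates n)

  ∈-geodesics⁻ : ∀ {u v p} → p ∈ geodesics u v → IsGeodesic G u v p
  ∈-geodesics⁻ {u} {v} p∈ = proj₂ (∈-filter⁻ (isGeodesic? G u v) {xs = candidates n} p∈)

  starts-unique : ∀ {u u′ v v′ p} → IsPath G u v p → IsPath G u′ v′ p → u ≡ u′
  starts-unique path path′ = just-injective (trans (sym (starts path)) (starts path′))

  ends-unique : ∀ {u u′ v v′ p} → IsPath G u v p → IsPath G u′ v′ p → v ≡ v′
  ends-unique path path′ = just-injective (trans (sym (ends path)) (ends path′))

  -- Geodesics to a fixed target, layer by layer.

  module ToTarget (conn : Connected G) (v : Fin n) where

    -- The distance to v, counted in vertices instead of edges.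
    δ : Fin n → ℕ
    δ x = length (proj₁ (geodesic conn x v))

    IsGeodesic⇒δ : ∀ {x p} → IsGeodesic G x v p → δ x ≡ length p
    IsGeodesic⇒δ {x} {p} (path , shortest) =
      let q , path′ , shortest′ = geodesic conn x v
      in ℕ.≤-antisym (shortest′ p path) (shortest q path′)

    δ-target : δ v ℕ.≤ 1
    δ-target = proj₂ (proj₂ (geodesic conn v v)) (v ∷ []) (mkPath refl refl [-] ([] ∷ []))

    sphere : ℕ → List (Fin n)
    sphere k = filter (λ x → δ x ℕ.≟ k) (allFin n)

    beyond : ℕ → List (Fin n)
    beyond k = filter (λ x → k ℕ.≤? δ x) (allFin n)

    sphere+beyond : ∀ k → length (sphere k) ℕ.+ length (beyond (suc k)) ℕ.≤ length (beyond k)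
    sphere+beyond k = length-filter-disjoint _ _ _ (λ eq → ℕ.≤-reflexive (sym eq)) ℕ.<⇒≤
      (λ eq k<δ → ℕ.<-irrefl (sym eq) k<δ) (allFin n)

    -- Adjacency is not checked. The resulting overcount makes the number of lists exactly a product
    -- of sphere sizes.
    extend : ℕ → List (List (Fin n)) → List (List (Fin n))
    extend k ps = cartesianProductWith _∷_ (sphere k) ps

    -- The lists obtained from `ps` by passing through sphere k, then k + 1, and so on, stopping
    -- after any sphere; `fuel` is the number of spheres available.
    layers : ℕ → ℕ → List (List (Fin n)) → List (List (Fin n))
    layers zero       k ps = []
    layers (suc fuel) k ps = extend k ps ++ layers fuel (suc k) (extend k ps)

    -- Each of the w · a lists in `extend k ps` counts once for itself and at most f times for its
    -- continuations, giving w · a (1 + f), to which `maxPathCount-layer` applies.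
    length-layers : ∀ fuel k ps →
      length (layers fuel k ps) ℕ.≤ length ps ℕ.* maxPathCount (length (beyond k))
    length-layers zero       k ps = z≤n
    length-layers (suc fuel) k ps = begin
      length (extend k ps ++ layers fuel (suc k) (extend k ps))
        ≡⟨ length-++ (extend k ps) ⟩
      length (extend k ps) ℕ.+ length (layers fuel (suc k) (extend k ps))
        ≤⟨ ℕ.+-monoʳ-≤ _ (length-layers fuel (suc k) (extend k ps)) ⟩
      length (extend k ps) ℕ.+ length (extend k ps) ℕ.* f
        ≡⟨ cong (λ l → l ℕ.+ l ℕ.* f) (length-cartesianProductWith _∷_ (sphere k) ps) ⟩
      a ℕ.* w ℕ.+ a ℕ.* w ℕ.* f
        ≡⟨ solve 3 (λ a w f → a :* w :+ a :* w :* f := w :* (a :* (con 1 :+ f))) refl a w f ⟩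
      w ℕ.* (a ℕ.* suc f)
        ≤⟨ ℕ.*-monoʳ-≤ w (maxPathCount-layer a (length (beyond (suc k)))) ⟩
      w ℕ.* maxPathCount (a ℕ.+ length (beyond (suc k)))
        ≤⟨ ℕ.*-monoʳ-≤ w (maxPathCount-mono (sphere+beyond k)) ⟩
      w ℕ.* maxPathCount (length (beyond k)) ∎
      where
      open ℕ-Solver using (solve; _:=_; _:+_; _:*_; con)
      open ℕ.≤-Reasoning
      a = length (sphere k)
      w = length ps
      f = maxPathCount (length (beyond (suc k)))

    ContainsLength : ℕ → List (List (Fin n)) → Set
    ContainsLength k ps = ∀ {x p} → IsGeodesic G x v p → length p ≡ k → p ∈ ps

    -- The first vertex of a geodesic to `v` lies in the sphere given by the length, and the tail is
    -- again a geodesic. Starting at `2+ k` guarantees that the tail is nonempty.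
    extend-contains : ∀ k {ps} → ContainsLength (suc k) ps → ContainsLength (2+ k) (extend (2+ k) ps)
    extend-contains k hyp {p = x ∷ y ∷ p} geo@(mkPath refl _ _ _ , _) eq =
      ∈-cartesianProductWith⁺ _∷_
        (∈-filter⁺ (λ z → δ z ℕ.≟ 2+ k) (∈-allFin x) (trans (IsGeodesic⇒δ geo) eq))
        (hyp (IsGeodesic-tail geo) (ℕ.suc-injective eq))

    layers-contain : ∀ fuel k {ps} → ContainsLength (suc k) ps → ∀ {x p} → IsGeodesic G x v p →
      2+ k ℕ.≤ length p → length p ℕ.≤ fuel ℕ.+ suc k → p ∈ layers fuel (2+ k) ps
    layers-contain zero       k hyp geo lower upper =
      -- Without fuel the length would be at least k + 2 and at most k + 1.
      contradiction (ℕ.≤-trans lower upper) (ℕ.<-irrefl refl)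
    layers-contain (suc fuel) k {ps} hyp {p = p} geo lower upper with length p ℕ.≟ 2+ k
    ... | yes eq = ∈-++⁺ˡ (extend-contains k hyp geo eq)
    ... | no neq = ∈-++⁺ʳ (extend (2+ k) ps) (layers-contain fuel (suc k) (extend-contains k hyp) geo
      (ℕ.≤∧≢⇒< lower (neq ∘ sym)) (ℕ.≤-trans upper (ℕ.≤-reflexive (sym (ℕ.+-suc fuel (suc k))))))

    -- As `δ` counts vertices, the neighbours of `v` form sphere 2. Fuel `n` suffices because a path
    -- has at most `n` vertices.
    nontrivial : List (List (Fin n))
    nontrivial = layers n 2 ((v ∷ []) ∷ [])

    ∈-nontrivial : ∀ {u p} → IsGeodesic G u v p → u ≢ v → p ∈ nontrivial
    ∈-nontrivial geo@(path , _) u≢v = layers-contain n 0 trivial geo (two path)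
      (ℕ.≤-trans (unique⇒length≤ (unique path)) (ℕ.m≤m+n n 1))
      where
      trivial : ContainsLength 1 ((v ∷ []) ∷ [])
      trivial {p = _ ∷ []} (mkPath _ refl _ _ , _) refl = here refl

      two : ∀ {p} → IsPath G _ v p → 2 ℕ.≤ length p
      two {_ ∷ []}    (mkPath refl refl _ _) = contradiction refl u≢v
      two {_ ∷ _ ∷ _} _                      = s≤s (s≤s z≤n)

    -- The target `v` itself is left out, which is where n - 1 comes from.
    beyond-2-proper : length (beyond 2) ℕ.< n
    beyond-2-proper = subst (length (beyond 2) ℕ.<_) (length-tabulate {n = n} id)
      (filter-notAll (λ x → 2 ℕ.≤? δ x) (allFin n)
        (lose (∈-allFin v) (ℕ.<⇒≱ (s≤s δ-target))))

    length-nontrivial : length nontrivial ℕ.≤ maxPathCount (ℕ.pred n)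
    length-nontrivial = ℕ.≤-trans (length-layers n 2 ((v ∷ []) ∷ []))
      (ℕ.≤-trans (ℕ.≤-reflexive (ℕ.*-identityˡ _))
        (maxPathCount-mono (ℕ.<⇒≤pred beyond-2-proper)))

  -- Double counting of geodesics by their targets.

  increasing : List (Fin n × Fin n)
  increasing = filter (λ (u , v) → u Fin.<? v) (cartesianProduct (allFin n) (allFin n))

  increasingGeodesics : List (List (Fin n))
  increasingGeodesics = concatMap (uncurry geodesics) increasing

  increasingGeodesics-unique : Unique increasingGeodesics
  increasingGeodesics-unique = concatMap-unique
    (Unique.filter⁺ (λ (u , v) → u Fin.<? v)
      (Unique.cartesianProduct⁺ (Unique.allFin⁺ n) (Unique.allFin⁺ n)))
    (λ (u , v) → Unique.filter⁺ (isGeodesic? G u v) (candidates-unique n))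
    (λ p∈ p∈′ → let path , _ = ∈-geodesics⁻ p∈ ; path′ , _ = ∈-geodesics⁻ p∈′
      in cong₂ _,_ (starts-unique path path′) (ends-unique path path′))

  ∈-increasingGeodesics⁻ : ∀ {p} → p ∈ increasingGeodesics →
    ∃ λ u → ∃ λ v → u Fin.< v × IsGeodesic G u v p
  ∈-increasingGeodesics⁻ p∈ =
    let (u , v) , uv∈ , p∈uv = find (∈-concatMap⁻ (uncurry geodesics) {xs = increasing} p∈)
    in u , v
     , proj₂ (∈-filter⁻ (λ (u , v) → u Fin.<? v) {xs = cartesianProduct (allFin n) (allFin n)} uv∈)
     , ∈-geodesics⁻ p∈uv

  -- The geodesics from smaller to larger ends and their reversals form a list without repetition.
  -- Sorted by its last vertex, every entry lies in some `nontrivial v`, and each of these `n` lists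
  -- has length at most `maxPathCount (ℕ.pred n)`.
  twice-increasingGeodesics : Connected G →
    2 ℕ.* length increasingGeodesics ℕ.≤ n ℕ.* maxPathCount (ℕ.pred n)
  twice-increasingGeodesics conn = begin
    2 ℕ.* length increasingGeodesics
      ≡⟨ cong (length increasingGeodesics ℕ.+_) (ℕ.+-identityʳ _) ⟩
    length increasingGeodesics ℕ.+ length increasingGeodesics
      ≡⟨ cong (length increasingGeodesics ℕ.+_) (length-map reverse increasingGeodesics) ⟨
    length increasingGeodesics ℕ.+ length reversed
      ≡⟨ length-++ increasingGeodesics ⟨
    length (increasingGeodesics ++ reversed)
      ≤⟨ unique-⊆⇒length≤ (Unique.++⁺ increasingGeodesics-unique
           (Unique.map⁺ reverse-injective increasingGeodesics-unique) disjoint) covered ⟩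
    length (concatMap nontrivial (allFin n))
      ≤⟨ length-concatMap-≤ nontrivial (allFin n) length-nontrivial ⟩
    length (allFin n) ℕ.* maxPathCount (ℕ.pred n)
      ≡⟨ cong (ℕ._* maxPathCount (ℕ.pred n)) (length-tabulate {n = n} id) ⟩
    n ℕ.* maxPathCount (ℕ.pred n) ∎
    where
    open ℕ.≤-Reasoning
    open ToTarget conn using (nontrivial; ∈-nontrivial; length-nontrivial)
    reversed = map reverse increasingGeodesics

    disjoint : ∀ {p} → ¬ (p ∈ increasingGeodesics × p ∈ reversed)
    disjoint (p∈ , p∈ʳ) with ∈-map⁻ reverse p∈ʳ
    ... | q , q∈ , refl with ∈-increasingGeodesics⁻ p∈ | ∈-increasingGeodesics⁻ q∈
    -- Reversal swaps the ends, so a common member would have its ends ordered both ways.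
    ... | u , v , u<v , path , _ | u′ , v′ , u′<v′ , path′ , _ = Fin.<-asym u′<v′
      (subst₂ Fin._<_ (starts-unique path (IsPath-reverse path′))
        (ends-unique path (IsPath-reverse path′)) u<v)

    ∈-all : ∀ {u v p} → IsGeodesic G u v p → u ≢ v → p ∈ concatMap nontrivial (allFin n)
    ∈-all {v = v} geo u≢v =
      ∈-concatMap⁺ nontrivial (lose (∈-allFin v) (∈-nontrivial v geo u≢v))

    covered : increasingGeodesics ++ reversed ⊆ concatMap nontrivial (allFin n)
    covered p∈ with ∈-++⁻ increasingGeodesics p∈
    ... | inj₁ p∈ˡ = let _ , _ , u<v , geo = ∈-increasingGeodesics⁻ p∈ˡ in ∈-all geo (Fin.<⇒≢ u<v)
    ... | inj₂ p∈ʳ with ∈-map⁻ reverse p∈ʳ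
    ...   | q , q∈ , refl = let _ , _ , u<v , geo = ∈-increasingGeodesics⁻ q∈
      in ∈-all (IsGeodesic-reverse geo) (Fin.<⇒≢ u<v ∘ sym)

  twice-gpn : Connected G → 2 ℕ.* gpn G ℕ.≤ n ℕ.* (maxPathCount (ℕ.pred n) ℕ.+ 2)
  twice-gpn conn = begin
    2 ℕ.* gpn G
      ≡⟨ cong (λ s → 2 ℕ.* (s ℕ.+ n)) (length-concatMap (uncurry geodesics) increasing) ⟨
    2 ℕ.* (length increasingGeodesics ℕ.+ n)
      ≡⟨ ℕ.*-distribˡ-+ 2 (length increasingGeodesics) n ⟩
    2 ℕ.* length increasingGeodesics ℕ.+ 2 ℕ.* n
      ≤⟨ ℕ.+-monoˡ-≤ (2 ℕ.* n) (twice-increasingGeodesics conn) ⟩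
    n ℕ.* maxPathCount (ℕ.pred n) ℕ.+ 2 ℕ.* n
      ≡⟨ cong (n ℕ.* maxPathCount (ℕ.pred n) ℕ.+_) (ℕ.*-comm 2 n) ⟩
    n ℕ.* maxPathCount (ℕ.pred n) ℕ.+ n ℕ.* 2
      ≡⟨ ℕ.*-distribˡ-+ n _ 2 ⟨
    n ℕ.* (maxPathCount (ℕ.pred n) ℕ.+ 2) ∎
    where open ℕ.≤-Reasoning

-- Natural numbers and fractions inside ℚ.

fromℚᵘ-homo-* : ∀ p q → fromℚᵘ (p ℚᵘ.* q) ≡ fromℚᵘ p ℚ.* fromℚᵘ q
fromℚᵘ-homo-* p q = ℚ.toℚᵘ-injective (begin
  toℚᵘ (fromℚᵘ (p ℚᵘ.* q))                  ≈⟨ ℚ.toℚᵘ-fromℚᵘ (p ℚᵘ.* q) ⟩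
  p ℚᵘ.* q                                  ≈⟨ ℚᵘ.*-cong (ℚ.toℚᵘ-fromℚᵘ p) (ℚ.toℚᵘ-fromℚᵘ q) ⟨
  toℚᵘ (fromℚᵘ p) ℚᵘ.* toℚᵘ (fromℚᵘ q)      ≈⟨ ℚ.toℚᵘ-homo-* (fromℚᵘ p) (fromℚᵘ q) ⟨
  toℚᵘ (fromℚᵘ p ℚ.* fromℚᵘ q)              ∎)
  where open ℚᵘ.≃-Reasoning

fromℚᵘ-homo-+ : ∀ p q → fromℚᵘ (p ℚᵘ.+ q) ≡ fromℚᵘ p ℚ.+ fromℚᵘ q
fromℚᵘ-homo-+ p q = ℚ.toℚᵘ-injective (begin
  toℚᵘ (fromℚᵘ (p ℚᵘ.+ q))                  ≈⟨ ℚ.toℚᵘ-fromℚᵘ (p ℚᵘ.+ q) ⟩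
  p ℚᵘ.+ q                                  ≈⟨ ℚᵘ.+-cong (ℚ.toℚᵘ-fromℚᵘ p) (ℚ.toℚᵘ-fromℚᵘ q) ⟨
  toℚᵘ (fromℚᵘ p) ℚᵘ.+ toℚᵘ (fromℚᵘ q)      ≈⟨ ℚ.toℚᵘ-homo-+ (fromℚᵘ p) (fromℚᵘ q) ⟨
  toℚᵘ (fromℚᵘ p ℚ.+ fromℚᵘ q)              ∎)
  where open ℚᵘ.≃-Reasoning

fromℚᵘ-mono-≤ : ∀ {p q} → p ℚᵘ.≤ q → fromℚᵘ p ℚ.≤ fromℚᵘ q
fromℚᵘ-mono-≤ {p} {q} p≤q = ℚ.toℚᵘ-cancel-≤ (begin
  toℚᵘ (fromℚᵘ p)  ≃⟨ ℚ.toℚᵘ-fromℚᵘ p ⟩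
  p                ≤⟨ p≤q ⟩
  q                ≃⟨ ℚ.toℚᵘ-fromℚᵘ q ⟨
  toℚᵘ (fromℚᵘ q)  ∎)
  where open ℚᵘ.≤-Reasoning

-- `_^ℚ_` reads its exponent in lowest terms; this equation ties those terms to the fraction as
-- written.
↥/↧-/ : ∀ i d → ↥ (i / suc d) ℤ.* + suc d ≡ i ℤ.* ↧ (i / suc d)
↥/↧-/ i d = cross (i / suc d) (ℚ.toℚᵘ-fromℚᵘ (mkℚᵘ i d))
  where
  cross : ∀ p → toℚᵘ p ℚᵘ.≃ mkℚᵘ i d → ↥ p ℤ.* + suc d ≡ i ℤ.* ↧ p
  cross (ℚ.mkℚ _ _ _) (*≡* eq) = eq

ι : ℕ → ℚ
ι m = + m / 1

ι-* : ∀ a b → ι (a ℕ.* b) ≡ ι a ℚ.* ι b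
ι-* a b = trans (ℚ.fromℚᵘ-cong {mkℚᵘ (+ (a ℕ.* b)) 0} {p ℚᵘ.* q} (*≡* (cong (ℤ._* + 1) (ℤ.pos-* a b))))
  (fromℚᵘ-homo-* p q)
  where
  p = mkℚᵘ (+ a) 0
  q = mkℚᵘ (+ b) 0

ι-+ : ∀ a b → ι (a ℕ.+ b) ≡ ι a ℚ.+ ι b
ι-+ a b = trans (ℚ.fromℚᵘ-cong {mkℚᵘ (+ (a ℕ.+ b)) 0} {p ℚᵘ.+ q} (*≡* (cong (ℤ._* + 1)
    (sym (cong₂ ℤ._+_ (ℤ.*-identityʳ (+ a)) (ℤ.*-identityʳ (+ b)))))))
  (fromℚᵘ-homo-+ p q)
  where
  p = mkℚᵘ (+ a) 0
  q = mkℚᵘ (+ b) 0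

ι-^ : ∀ a k → ι (a ℕ.^ k) ≡ ι a ^ k
ι-^ a zero    = refl
ι-^ a (suc k) = trans (ι-* a (a ℕ.^ k)) (cong (ι a ℚ.*_) (ι-^ a k))

ι-mono-≤ : ∀ {a b} → a ℕ.≤ b → ι a ℚ.≤ ι b
ι-mono-≤ {a} {b} a≤b = fromℚᵘ-mono-≤ {mkℚᵘ (+ a) 0} {mkℚᵘ (+ b) 0}
  (*≤* (ℤ.*-monoʳ-≤-nonNeg (+ 1) (ℤ.+≤+ a≤b)))

-- Powers with rational exponents.

^-cancel-≤ : ∀ {s r} k .{{_ : ℕ.NonZero k}} → 0ℚ ℚ.≤ r → s ^ k ℚ.≤ r ^ k → s ℚ.≤ r
^-cancel-≤ k 0≤r le = ℚ.≮⇒≥ λ r<s → ℚ.<-irrefl refl (ℚ.<-≤-trans (^-mono-< k 0≤r r<s) le)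

1^ : ∀ k → 1ℚ ^ k ≡ 1ℚ
1^ zero    = refl
1^ (suc k) = trans (ℚ.*-identityˡ (1ℚ ^ k)) (1^ k)

-- Multiplying by a ^ (6 k) keeps the exponent on the right-hand side natural.
cube-^ℤ : ∀ a .{{_ : Positive a}} n k z → z ℤ.* + 3 ≡ (+ n - + 6) ℤ.* + k →
  (a ^ℤ z) ^ 3 ℚ.* a ^ (6 ℕ.* k) ≡ a ^ (n ℕ.* k)
cube-^ℤ a n k (+ j) eq = begin
  (a ^ j) ^ 3 ℚ.* a ^ (6 ℕ.* k)         ≡⟨ cong (ℚ._* a ^ (6 ℕ.* k)) (^-assocʳ a j 3) ⟩
  a ^ (j ℕ.* 3) ℚ.* a ^ (6 ℕ.* k)       ≡⟨ ^-homo-* a (j ℕ.* 3) (6 ℕ.* k) ⟨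
  a ^ (j ℕ.* 3 ℕ.+ 6 ℕ.* k)             ≡⟨ cong (a ^_) (ℤ.+-injective exponents) ⟩
  a ^ (n ℕ.* k)                         ∎
  where
  open ≡-Reasoning
  open ℤ-Solver
  exponents : + (j ℕ.* 3 ℕ.+ 6 ℕ.* k) ≡ + (n ℕ.* k)
  exponents = begin
    + (j ℕ.* 3) ℤ.+ + (6 ℕ.* k)             ≡⟨ cong₂ ℤ._+_ (ℤ.pos-* j 3) (ℤ.pos-* 6 k) ⟩
    + j ℤ.* + 3 ℤ.+ + 6 ℤ.* + k             ≡⟨ cong (ℤ._+ + 6 ℤ.* + k) eq ⟩
    (+ n - + 6) ℤ.* + k ℤ.+ + 6 ℤ.* + k     ≡⟨
      solve 3 (λ n c k → (n :- c) :* k :+ c :* k := n :* k) refl (+ n) (+ 6) (+ k) ⟩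
    + n ℤ.* + k                             ≡⟨ ℤ.pos-* n k ⟨
    + (n ℕ.* k)                             ∎
-- For the exponent -(j + 1), `eq` amounts to 3 (j + 1) + n k = 6 k. Hence `a ^ (6 ℕ.* k)` has the
-- factor `a ^ i`, which cancels the power of the inverse.
cube-^ℤ a n k -[1+ j ] eq = begin
  (b ^ suc j) ^ 3 ℚ.* a ^ (6 ℕ.* k)                 ≡⟨
    cong₂ ℚ._*_ (^-assocʳ b (suc j) 3) (cong (a ^_) (sym (ℤ.+-injective exponents))) ⟩
  b ^ i ℚ.* a ^ (i ℕ.+ n ℕ.* k)                     ≡⟨ cong (b ^ i ℚ.*_) (^-homo-* a i (n ℕ.* k)) ⟩
  b ^ i ℚ.* (a ^ i ℚ.* a ^ (n ℕ.* k))               ≡⟨ ℚ.*-assoc (b ^ i) (a ^ i) _ ⟨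
  b ^ i ℚ.* a ^ i ℚ.* a ^ (n ℕ.* k)                 ≡⟨ cong (ℚ._* a ^ (n ℕ.* k)) (^-distrib-* b a i) ⟨
  (b ℚ.* a) ^ i ℚ.* a ^ (n ℕ.* k)                   ≡⟨
    cong (λ x → x ^ i ℚ.* a ^ (n ℕ.* k)) (ℚ.*-inverseˡ a {{ℚ.pos⇒nonZero a}}) ⟩
  1ℚ ^ i ℚ.* a ^ (n ℕ.* k)                          ≡⟨ cong (ℚ._* a ^ (n ℕ.* k)) (1^ i) ⟩
  1ℚ ℚ.* a ^ (n ℕ.* k)                              ≡⟨ ℚ.*-identityˡ _ ⟩
  a ^ (n ℕ.* k)                                     ∎
  where
  open ≡-Reasoning
  open ℤ-Solver
  b = (1/ a) {{ℚ.pos⇒nonZero a}}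
  i = suc j ℕ.* 3
  exponents : + (i ℕ.+ n ℕ.* k) ≡ + (6 ℕ.* k)
  exponents = begin
    + i ℤ.+ + (n ℕ.* k)                                 ≡⟨ cong₂ ℤ._+_ (ℤ.pos-* (suc j) 3) (ℤ.pos-* n k) ⟩
    + suc j ℤ.* + 3 ℤ.+ + n ℤ.* + k                     ≡⟨
      solve 5 (λ s t n c k → s :* t :+ n :* k :=
        c :* k :+ ((n :- c) :* k :- :- s :* t)) refl (+ suc j) (+ 3) (+ n) (+ 6) (+ k) ⟩
    + 6 ℤ.* + k ℤ.+ ((+ n - + 6) ℤ.* + k - -[1+ j ] ℤ.* + 3) ≡⟨
      cong (λ x → + 6 ℤ.* + k ℤ.+ (x - -[1+ j ] ℤ.* + 3)) eq ⟨
    + 6 ℤ.* + k ℤ.+ (-[1+ j ] ℤ.* + 3 - -[1+ j ] ℤ.* + 3)    ≡⟨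
      cong (ℤ._+_ (+ 6 ℤ.* + k)) (ℤ.+-inverseʳ (-[1+ j ] ℤ.* + 3)) ⟩
    + 6 ℤ.* + k ℤ.+ + 0                                 ≡⟨ ℤ.+-identityʳ _ ⟩
    + 6 ℤ.* + k                                         ≡⟨ ℤ.pos-* 6 k ⟨
    + (6 ℕ.* k)                                         ∎

-- The exponent is reduced to lowest terms, so k can be 1 as well as 3.
below-^ℚ : ∀ a .{{_ : Positive a}} n {c s} → 0ℚ ℚ.≤ c → c ^ 3 ℚ.* a ^ 6 ℚ.≤ a ^ n → s ℚ.< c →
  ℝ.L (a ^ℚ ((+ n - + 6) / 3)) s
below-^ℚ a n {c} 0≤c bound s<c = c , 0≤c , ^-cancel-≤ 3 (^ℤ-nonNeg a z) cubes , s<c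
  where
  z = ↥ ((+ n - + 6) / 3)
  k = ↧ₙ ((+ n - + 6) / 3)

  cubes : (c ^ k) ^ 3 ℚ.≤ (a ^ℤ z) ^ 3
  -- Multiplied by `a ^ (6 ℕ.* k)`, this is the k-th power of `bound`.
  cubes = ℚ.*-cancelʳ-≤-pos (a ^ (6 ℕ.* k)) {{ℚ.positive (^-pos (6 ℕ.* k) (ℚ.positive⁻¹ a))}} (begin
    (c ^ k) ^ 3 ℚ.* a ^ (6 ℕ.* k)         ≡⟨
      cong₂ ℚ._*_ (trans (^-assocʳ c k 3) (trans (cong (c ^_) (ℕ.*-comm k 3)) (sym (^-assocʳ c 3 k))))
        (sym (^-assocʳ a 6 k)) ⟩
    (c ^ 3) ^ k ℚ.* (a ^ 6) ^ k           ≡⟨ ^-distrib-* (c ^ 3) (a ^ 6) k ⟨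
    (c ^ 3 ℚ.* a ^ 6) ^ k                 ≤⟨ ^-mono-≤ k nonNeg bound ⟩
    (a ^ n) ^ k                           ≡⟨ ^-assocʳ a n k ⟩
    a ^ (n ℕ.* k)                         ≡⟨ cube-^ℤ a n k z (↥/↧-/ (+ n - + 6) 2) ⟨
    (a ^ℤ z) ^ 3 ℚ.* a ^ (6 ℕ.* k)        ∎)
    where
    open ℚ.≤-Reasoning
    nonNeg : 0ℚ ℚ.≤ c ^ 3 ℚ.* a ^ 6
    nonNeg = ℚ.nonNegative⁻¹ _ {{ℚ.nonNeg*nonNeg⇒nonNeg (c ^ 3) {{ℚ.nonNegative (^-nonNeg 3 0≤c)}}
      (a ^ 6) {{ℚ.nonNegative (^-nonNeg 6 (ℚ.<⇒≤ (ℚ.positive⁻¹ a)))}}}}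

-- Lower cuts and the final estimate.

-- The lower cut of a scaled real asks for a witness strictly inside. Density gives m between p and
-- a b, and m / a serves.
below-product : ∀ a .{{_ : Positive a}} {p b} → p ℚ.< a ℚ.* b → ∃ λ r → r ℚ.< b × p ℚ.< a ℚ.* r
below-product a {p} {b} p<ab =
  let m , p<m , m<ab = ℚ.<-dense p<ab
      am = trans (sym (ℚ.*-assoc a (1/ a) m)) (trans (cong (ℚ._* m) (ℚ.*-inverseʳ a)) (ℚ.*-identityˡ m))
  in 1/ a ℚ.* m
   , ℚ.*-cancelˡ-<-nonNeg a {{ℚ.pos⇒nonNeg a}} (subst (ℚ._< a ℚ.* b) (sym am) m<ab)
   , subst (p ℚ.<_) (sym am) p<m
  where instance _ = ℚ.pos⇒nonZero a

ι-*-/ : ∀ d m → ι (suc d) ℚ.* (+ m / suc d) ≡ ι m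
ι-*-/ d m = trans (sym (fromℚᵘ-homo-* p q)) (ℚ.fromℚᵘ-cong {p ℚᵘ.* q} {mkℚᵘ (+ m) 0} (*≡* (begin
  + suc d ℤ.* + m ℤ.* + 1       ≡⟨ ℤ.*-identityʳ (+ suc d ℤ.* + m) ⟩
  + suc d ℤ.* + m               ≡⟨ ℤ.*-comm (+ suc d) (+ m) ⟩
  + m ℤ.* + suc d               ≡⟨ cong (λ x → + m ℤ.* + suc x) (ℕ.+-identityʳ d) ⟨
  + m ℤ.* + suc (d ℕ.+ 0)       ∎)))
  where
  open ≡-Reasoning
  p = mkℚᵘ (+ suc d) 0
  q = mkℚᵘ (+ m) d

ι-≤-n/4 : ∀ {g n d} → 4 ℕ.* g ℕ.≤ n ℕ.* d → ι g ℚ.≤ (+ n / 4) ℚ.* ι d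
ι-≤-n/4 {g} {n} {d} le = ℚ.*-cancelˡ-≤-pos (ι 4) (begin
  ι 4 ℚ.* ι g                   ≡⟨ ι-* 4 g ⟨
  ι (4 ℕ.* g)                   ≤⟨ ι-mono-≤ le ⟩
  ι (n ℕ.* d)                   ≡⟨ ι-* n d ⟩
  ι n ℚ.* ι d                   ≡⟨ cong (ℚ._* ι d) (ι-*-/ 3 n) ⟨
  ι 4 ℚ.* (+ n / 4) ℚ.* ι d     ≡⟨ ℚ.*-assoc (ι 4) (+ n / 4) (ι d) ⟩
  ι 4 ℚ.* ((+ n / 4) ℚ.* ι d)   ∎)
  where open ℚ.≤-Reasoning

cube-/23 : ∀ n d → 729 ℕ.* d ℕ.^ 3 ℕ.≤ 12167 ℕ.* 3 ℕ.^ n → (+ d / 23) ^ 3 ℚ.* ι 3 ^ 6 ℚ.≤ ι 3 ^ n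
cube-/23 n d le = ℚ.*-cancelˡ-≤-pos (ι 12167) (begin
  -- `ι 12167` and `ι 729` evaluate to the same rationals as `ι 23 ^ 3` and `ι 3 ^ 6`.
  ι 12167 ℚ.* (c ^ 3 ℚ.* ι 729)    ≡⟨ ℚ.*-assoc (ι 23 ^ 3) (c ^ 3) (ι 729) ⟨
  ι 23 ^ 3 ℚ.* c ^ 3 ℚ.* ι 729     ≡⟨ cong (ℚ._* ι 729) (^-distrib-* (ι 23) c 3) ⟨
  (ι 23 ℚ.* c) ^ 3 ℚ.* ι 729       ≡⟨ cong (λ x → x ^ 3 ℚ.* ι 729) (ι-*-/ 22 d) ⟩
  ι d ^ 3 ℚ.* ι 729                ≡⟨ ℚ.*-comm (ι d ^ 3) (ι 729) ⟩
  ι 729 ℚ.* ι d ^ 3                ≡⟨ cong (ι 729 ℚ.*_) (ι-^ d 3) ⟨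
  ι 729 ℚ.* ι (d ℕ.^ 3)            ≡⟨ ι-* 729 (d ℕ.^ 3) ⟨
  ι (729 ℕ.* d ℕ.^ 3)              ≤⟨ ι-mono-≤ le ⟩
  ι (12167 ℕ.* 3 ℕ.^ n)            ≡⟨ ι-* 12167 (3 ℕ.^ n) ⟩
  ι 12167 ℚ.* ι (3 ℕ.^ n)          ≡⟨ cong (ι 12167 ℚ.*_) (ι-^ 3 n) ⟩
  ι 12167 ℚ.* ι 3 ^ n              ∎)
  where
  open ℚ.≤-Reasoning
  c = + d / 23

-- The factor 2 (f + 2) is split as (2 f + 3) + 1, so that 2 f + 3 faces the power term and 1 the
-- summand 1 of the bound.
four-gpn : ∀ {n} (G : Graph n) → Connected G →
  4 ℕ.* gpn G ℕ.≤ n ℕ.* (2 ℕ.* maxPathCount (ℕ.pred n) ℕ.+ 3 ℕ.+ 1)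
four-gpn {n} G conn = begin
  4 ℕ.* gpn G                         ≡⟨ ℕ.*-assoc 2 2 (gpn G) ⟩
  2 ℕ.* (2 ℕ.* gpn G)                 ≤⟨ ℕ.*-monoʳ-≤ 2 (twice-gpn G conn) ⟩
  2 ℕ.* (n ℕ.* (m ℕ.+ 2))             ≡⟨ solve 2 (λ n m → con 2 :* (n :* (m :+ con 2)) :=
                                           n :* (con 2 :* m :+ con 3 :+ con 1)) refl n m ⟩
  n ℕ.* (2 ℕ.* m ℕ.+ 3 ℕ.+ 1)         ∎
  where
  open ℕ-Solver using (solve; _:=_; _:+_; _:*_; con)
  open ℕ.≤-Reasoning
  m = maxPathCount (ℕ.pred n)

theorem2 : (n : ℕ) → n ≥ 1 → (G : Graph n) → Connected G →
    let instance n/4≥0 = normalize-nonNeg n 4 in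
    fromℚ (+ gpn G / 1) ≤ᴿ (+ n / 4) · ((+ 23 / 1) · (+ 3 / 1) ^ℚ ((+ n - + 6) / 3) ⊕ + 1 / 1)
theorem2 n@(suc m) _ G conn p<gpn =
  -- The right-hand side is unwrapped from outside: p < (n / 4) r with r < d + 1, then r - 1 < 23 s
  -- with s < c = d / 23. By `cubic-bound`, c is at most the real power, so s lies in its lower cut.
  let r , r<d+1 , p<r = below-product (+ n / 4) {{ℚ.normalize-pos n 4}}
        (ℚ.<-≤-trans p<gpn (ι-≤-n/4 {g = gpn G} {n} {d ℕ.+ 1} (four-gpn G conn)))
      s , s<c , r-1<s = below-product (ι 23)
        (subst (r ℚ.- ι 1 ℚ.<_) d+1-1 (ℚ.+-monoˡ-< (ℚ.- ι 1) r<d+1))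
  in r , (s , below-^ℚ (ι 3) n 0≤c (cube-/23 n d (cubic-bound m)) s<c , r-1<s) , p<r
  where
  d = 2 ℕ.* maxPathCount m ℕ.+ 3
  c = + d / 23

  d+1-1 : ι (d ℕ.+ 1) ℚ.- ι 1 ≡ ι 23 ℚ.* c
  d+1-1 = trans (cong (ℚ._- ι 1) (ι-+ d 1)) (trans (x+b-b (ι d) (ι 1)) (sym (ι-*-/ 22 d)))

  0≤c : 0ℚ ℚ.≤ c
  0≤c = ℚ.nonNegative⁻¹ c {{normalize-nonNeg d 23}}
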